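{- Let $C=\ln 4/(\ln 4-1)\approx 3.588$. Let $G$ be a graph on $n$ vertices with minimum degree at least $\delta$, where $n$ and $\delta$ satisfy $n\ge (C-1)\delta^2+(3C-1)\delta+2$. Then either $G=K_{\delta,n-\delta}$ or $i(G)<i(K_{\delta,n-\delta})$.
   Context: All graphs are simple, loopless and finite. $i(G)$ denotes the total number of independent sets (vertex subsets spanning no edge, including the empty set) of $G$. $K_{a,b}$ is the complete bipartite graph with $a$ vertices in one part and $b$ in the other. -}

module Defs where

open import Data.Nat using (ℕ; zero; suc; _+_; _*_; _^_; _≤_; _<ᵇ_; _!)
open import Data.Nat.ListAction using (sum)
open import Data.Bool.ListAction using (and)
open import Data.Bool using (Bool; true; false; _∧_; _xor_; not; if_then_else_)
open import Data.Fin using (Fin; toℕ)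
open import Data.Fin.Permutation using (Permutation′; _⟨$⟩ʳ_)
open import Data.List using (List; []; _∷_; map; allFin; concatMap)
open import Data.Product using (Σ)
open import Relation.Binary.PropositionalEquality using (_≡_; refl)

record Graph (n : ℕ) : Set where
  field
    adj    : Fin n → Fin n → Bool
    sym    : ∀ u v → adj u v ≡ adj v u
    irrefl : ∀ v → adj v v ≡ false
open Graph public

degree : ∀ {n} → Graph n → Fin n → ℕ
degree {n} G v = sum (map (λ u → if adj G v u then 1 else 0) (allFin n))

MinDegreeAtLeast : ∀ {n} → Graph n → ℕ → Set
MinDegreeAtLeast {n} G δ = ∀ v → δ ≤ degree G v

allSubsets : ∀ n → List (Fin n → Bool)
allSubsets n = go n
  where
  go : ℕ → List (Fin n → Bool)
  go zero    = (λ _ → false) ∷ []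
  go (suc k) = concatMap (λ S → S ∷ (λ v → if toℕ v Data.Nat.≡ᵇ k then true else S v) ∷ []) (go k)
    where import Data.Nat

isIndependent : ∀ {n} → Graph n → (Fin n → Bool) → Bool
isIndependent {n} G S =
  and (concatMap (λ u → map (λ v → not (S u ∧ S v ∧ adj G u v)) (allFin n)) (allFin n))

i : ∀ {n} → Graph n → ℕ
i {n} G = sum (map (λ S → if isIndependent G S then 1 else 0) (allSubsets n))

private
  xor-comm : ∀ a b → a xor b ≡ b xor a
  xor-comm true true = refl
  xor-comm true false = refl
  xor-comm false true = refl
  xor-comm false false = refl

  xor-self : ∀ a → a xor a ≡ false
  xor-self true = refl
  xor-self false = refl

Kbip : (n δ : ℕ) → Graph n
Kbip n δ = record
  { adj    = λ u v → (toℕ u <ᵇ δ) xor (toℕ v <ᵇ δ)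
  ; sym    = λ u v → xor-comm (toℕ u <ᵇ δ) (toℕ v <ᵇ δ)
  ; irrefl = λ v → xor-self (toℕ v <ᵇ δ)
  }

_≅_ : ∀ {n} → Graph n → Graph n → Set
_≅_ {n} G H = Σ (Permutation′ n) λ π → ∀ u v → adj G u v ≡ adj H (π ⟨$⟩ʳ u) (π ⟨$⟩ʳ v)

-- The real inequality  ln 4 · b ≥ a  (a, b natural numbers), i.e. 4^b ≥ e^a,
-- expressed without reals: e^a = sup_N Σ_{k≤N} a^k/k!, so
-- e^a ≤ 4^b  iff  for all N,  expS a N ≤ 4^b · N!,  where
-- expS a N = N! · Σ_{k=0}^{N} a^k / k!  (a natural number).

expS : ℕ → ℕ → ℕ
expS a zero    = 1
expS a (suc N) = suc N * expS a N + a ^ suc N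

Ln4TimesGE : (b a : ℕ) → Set
Ln4TimesGE b a = ∀ N → expS a N ≤ 4 ^ b * N !

-- With C = ln4/(ln4-1):  n ≥ (C-1)δ² + (3C-1)δ + 2
--   ⇔  (n-2)(ln4-1) ≥ δ² + δ + 2δ·ln4
--   ⇔  2δ+2 ≤ n  and  ln4·(n-2-2δ) ≥ δ² + δ + (n-2).
SizeCondition : (n δ : ℕ) → Set
SizeCondition n δ =
  Σ (2 * δ + 2 ≤ n) λ _ →
    Ln4TimesGE (n Data.Nat.∸ (2 * δ + 2)) (δ * δ + δ + (n Data.Nat.∸ 2))
  where import Data.Nat

{-# OPTIONS --safe #-}
module Submission where

-- Write q = n − δ, so that K_{δ,q} has 2^q + 2^δ − 1 independent sets. If some vertex v has degree
-- at least q, delete it and induct on δ: at most 2^(δ−1) independent sets contain v, and equality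
-- forces K_{δ,q}. Otherwise i(G) ≤ 2^q, for one of two reasons. If G has no independent set of size
-- δ + 3, it has 3δ disjoint edges, so i(G) ≤ (3/4)^(3δ) 2^n, and (3/4)^3 = 27/64 < 1/2.
-- If v₁, …, v_{δ+3} is an independent set, sort the independent sets by the first v_j they contain:
-- at most 2^(q−j) contain v_j first, and at most 2^(n−δ−3) contain none. For j = 1 the bound improves
-- by a factor 3/4, since the non-neighbours of v₁ span an edge unless deg v₁ > δ (otherwise a
-- neighbour of v₁ would have degree at least q), and this saving pays for the last term.
-- Only n ≥ 7δ + 1 is used; it follows from the size condition with e^a weakened to 2^a, because
-- Σ_{k ≤ a} a^k / k! at least doubles when a is replaced by a + 1.

open import Defs renaming (sym to adj-sym; irrefl to adj-irrefl)
open import Data.Bool using (Bool; true; false; T; not; _∧_; _∨_; _xor_; if_then_else_)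
open import Data.Bool.ListAction using (and)
open import Data.Bool.Properties
  using (∧-zeroʳ; ∧-identityʳ; ∧-assoc; ∧-comm; ∧-conicalˡ; ∧-conicalʳ; not-injective; ⇔→≡; T-≡; T?)
open import Data.Fin using (Fin; toℕ; fromℕ<) renaming (zero to fzero; suc to fsuc)
open import Data.Fin.Permutation using (Permutation′; _⟨$⟩ʳ_; _∘ₚ_; cast-id)
open import Data.Fin.Properties using (toℕ-fromℕ<; toℕ<n; toℕ-injective; toℕ-cast)
open import Data.List
  using (List; []; _∷_; _++_; length; map; concatMap; foldr; allFin; filterᵇ; lookup; tabulate; take; drop)
open import Data.List.Membership.Propositional using (_∈_)
open import Data.List.Membership.Propositional.Properties using (∈-allFin; ∈-lookup)
open import Data.List.Membership.Propositional.Properties.WithK using (unique∧set⇒bag)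
open import Data.List.Properties
  using (length-++; filter-++; length-filter; length-take; take++drop≡id; ++-identityʳ;
         length-tabulate; lookup-tabulate; map-tabulate; map-cong)
open import Data.List.Relation.Binary.BagAndSetEquality using (∼bag⇒↭)
open import Data.List.Relation.Binary.Permutation.Propositional
open import Data.List.Relation.Binary.Permutation.Propositional.Properties
  using (↭-length; filter-↭; shift; shifts; All-resp-↭)
open import Data.List.Relation.Binary.Permutation.Setoid using (onIndices)
open import Data.List.Relation.Binary.Permutation.Setoid.Properties using (onIndices-lookup)
open import Data.List.Relation.Unary.All as All using (All; []; _∷_)
import Data.List.Relation.Unary.All.Properties as All
open import Data.List.Relation.Unary.AllPairs using (AllPairs; []; _∷_)
import Data.List.Relation.Unary.AllPairs.Properties as AllPairs
open import Data.List.Relation.Unary.Any using (here; there)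
open import Data.List.Relation.Unary.Unique.Propositional using (Unique)
open import Data.List.Relation.Unary.Unique.Propositional.Properties using (allFin⁺)
open import Data.Nat
open import Data.Nat.ListAction using (sum)
open import Data.Nat.Properties
open import Data.Nat.Tactic.RingSolver using (solve-∀)
open import Data.Product using (∃; ∃₂; _×_; _,_)
open import Data.Sum as Sum using (_⊎_; inj₁; inj₂)
open import Function using (_∘_; const; id; _⇔_; mk⇔; Equivalence)
open import Relation.Nullary using (yes; no; contradiction)
open import Relation.Binary.PropositionalEquality hiding (trans)
open import Relation.Binary.PropositionalEquality using () renaming (trans to ≡-trans)

-- Boolean identities and lists filtered by a Boolean predicate.

∧-swapʳ : ∀ a b c → (a ∧ b) ∧ c ≡ (a ∧ c) ∧ b
∧-swapʳ a b c = ≡-trans (∧-assoc a b c) (≡-trans (cong (a ∧_) (∧-comm b c)) (sym (∧-assoc a c b)))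

-- The two expansions of the count of u ∷ v ∷ W: a, b, c, d count the independent sets of W
-- extended by neither vertex, by v, by u, and by both.
exchange : ∀ x y z a b c d →
  a + (if y then b else 0) + (if x then c + (if y ∧ not z then d else 0) else 0) ≡
  a + (if x then c else 0) + (if y then b + (if x ∧ not z then d else 0) else 0)
exchange false false _ _ _ _ _ = refl
exchange false true _ a b _ _ = lem a b
  where
  lem : ∀ a b → a + b + 0 ≡ a + 0 + (b + 0)
  lem = solve-∀
exchange true false _ a _ c _ = lem a c
  where
  lem : ∀ a c → a + 0 + (c + 0) ≡ a + c + 0
  lem = solve-∀
exchange true true false a b c d = lem a b c d
  where
  lem : ∀ a b c d → a + b + (c + d) ≡ a + c + (b + d)
  lem = solve-∀
exchange true true true a b c _ = lem a b c
  where
  lem : ∀ a b c → a + b + (c + 0) ≡ a + c + (b + 0)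
  lem = solve-∀

module _ {A : Set} where

  filterᵇ-full : ∀ (p : A → Bool) W → length W ≤ length (filterᵇ p W) → All (λ x → p x ≡ true) W
  filterᵇ-full p [] _ = []
  filterᵇ-full p (x ∷ W) full with p x in px
  ... | true = px ∷ filterᵇ-full p W (s≤s⁻¹ full)
  ... | false = contradiction (≤-trans full (length-filter (T? ∘ p) W)) 1+n≰n

  filterᵇ-all : ∀ (p : A → Bool) W → All (λ x → p x ≡ true) W → filterᵇ p W ≡ W
  filterᵇ-all p [] [] = refl
  filterᵇ-all p (x ∷ W) (px ∷ pW) rewrite px = cong (x ∷_) (filterᵇ-all p W pW)

  filterᵇ-none : ∀ (p : A → Bool) W → All (λ x → p x ≡ false) W → filterᵇ p W ≡ []
  filterᵇ-none p [] [] = refl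
  filterᵇ-none p (x ∷ W) (px ∷ pW) rewrite px = filterᵇ-none p W pW

  length-filterᵇ-↭ : ∀ (p : A → Bool) {W W′} → W ↭ W′ → length (filterᵇ p W) ≡ length (filterᵇ p W′)
  length-filterᵇ-↭ p W↭ = ↭-length (filter-↭ _ W↭)

  length-filterᵇ-++ : ∀ (p : A → Bool) W W′ →
    length (filterᵇ p (W ++ W′)) ≡ length (filterᵇ p W) + length (filterᵇ p W′)
  length-filterᵇ-++ p W W′ = ≡-trans (cong length (filter-++ _ W W′)) (length-++ (filterᵇ p W))

  filterᵇ-partition : ∀ (p : A → Bool) W → W ↭ filterᵇ p W ++ filterᵇ (not ∘ p) W
  filterᵇ-partition p [] = refl
  filterᵇ-partition p (x ∷ W) with p x
  ... | true = prep x (filterᵇ-partition p W)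
  ... | false = trans (prep x (filterᵇ-partition p W)) (↭-sym (shift x (filterᵇ p W) _))

  filterᵇ-satisfies : ∀ (p : A → Bool) W → All (λ x → p x ≡ true) (filterᵇ p W)
  filterᵇ-satisfies p [] = []
  filterᵇ-satisfies p (x ∷ W) with p x in px
  ... | true = px ∷ filterᵇ-satisfies p W
  ... | false = filterᵇ-satisfies p W

  extract : ∀ (p : A → Bool) W →
    (∃₂ λ x W′ → W ↭ x ∷ W′ × p x ≡ true) ⊎ All (λ x → p x ≡ false) W
  extract p [] = inj₂ []
  extract p (x ∷ W) with p x in px | extract p W
  ... | true  | _ = inj₁ (x , W , refl , px)
  ... | false | inj₁ (y , W′ , W↭ , py) = inj₁ (y , x ∷ W′ , trans (prep x W↭) (swap x y refl) , py)
  ... | false | inj₂ none = inj₂ (px ∷ none)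

-- Counting the independent sets among the entries of a list of vertices.

module IndependentSets {V : Set} (adj : V → V → Bool) (adj-sym : ∀ u v → adj u v ≡ adj v u)
  (adj-irrefl : ∀ v → adj v v ≡ false) where

  -- The number of independent sets of the graph induced on a list of vertices, all of whose members
  -- satisfy p. A repeated entry counts as a twin: a further vertex with the same neighbours.
  cnt : (V → Bool) → List V → ℕ
  cnt p [] = 1
  cnt p (v ∷ W) = cnt p W + (if p v then cnt (λ u → p u ∧ not (adj v u)) W else 0)

  count : List V → ℕ
  count = cnt (const true)

  nbrs non-nbrs : V → List V → List V
  nbrs v = filterᵇ (adj v)
  non-nbrs v = filterᵇ (λ u → not (adj v u))

  deg : V → List V → ℕ
  deg v W = length (nbrs v W)

  cnt-cong : ∀ {p q} → (∀ v → p v ≡ q v) → ∀ W → cnt p W ≡ cnt q W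
  cnt-cong p≗q [] = refl
  cnt-cong {p} {q} p≗q (v ∷ W) rewrite p≗q v = cong₂ _+_ (cnt-cong p≗q W)
    (cong (if q v then_else 0) (cnt-cong (λ u → cong (_∧ not (adj v u)) (p≗q u)) W))

  -- Only a swap of two consecutive entries uses the graph: expanding at both vertices, in either
  -- order, yields the same four counts because `adj` is symmetric. Hence any vertex or edge can be
  -- brought to the front.
  cnt-↭ : ∀ {W W′} → W ↭ W′ → ∀ p → cnt p W ≡ cnt p W′
  cnt-↭ refl p = refl
  cnt-↭ (prep v W↭) p = cong₂ _+_ (cnt-↭ W↭ p) (cong (if p v then_else 0) (cnt-↭ W↭ _))
  cnt-↭ (trans W↭ W↭′) p = ≡-trans (cnt-↭ W↭ p) (cnt-↭ W↭′ p)
  cnt-↭ {u ∷ v ∷ W} {_ ∷ _ ∷ W′} (swap u v W↭) p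
    rewrite adj-sym v u | cnt-↭ W↭ p | cnt-↭ W↭ (λ x → p x ∧ not (adj u x))
          | cnt-↭ W↭ (λ x → p x ∧ not (adj v x)) | cnt-↭ W↭ (λ x → (p x ∧ not (adj u x)) ∧ not (adj v x))
          | cnt-cong (λ x → ∧-swapʳ (p x) (not (adj u x)) (not (adj v x))) W′ =
    exchange (p u) (p v) (adj u v) (cnt p W′) (cnt (λ x → p x ∧ not (adj v x)) W′)
      (cnt (λ x → p x ∧ not (adj u x)) W′) (cnt (λ x → (p x ∧ not (adj v x)) ∧ not (adj u x)) W′)

  -- The predicate lets `cnt` recurse on the tail of its list; here it is traded back for a deletion
  -- of vertices.
  cnt-filterᵇ : ∀ p q W → cnt (λ u → p u ∧ q u) W ≡ cnt p (filterᵇ q W)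
  cnt-filterᵇ p q [] = refl
  cnt-filterᵇ p q (v ∷ W) with q v
  ... | false rewrite ∧-zeroʳ (p v) = ≡-trans (+-identityʳ _) (cnt-filterᵇ p q W)
  ... | true rewrite ∧-identityʳ (p v) = cong₂ _+_ (cnt-filterᵇ p q W) (cong (if p v then_else 0)
    (≡-trans (cnt-cong (λ u → ∧-swapʳ (p u) (q u) _) W) (cnt-filterᵇ _ q W)))

  -- The standard recursion `i(G) = i(G − v) + i(G − N[v])`, splitting by whether `v` is chosen.
  count-∷ : ∀ v W → count (v ∷ W) ≡ count W + count (non-nbrs v W)
  count-∷ v W = cong (count W +_) (cnt-filterᵇ (const true) _ W)

  cnt-mono : ∀ {p q} → (∀ v → p v ≡ true → q v ≡ true) → ∀ W → cnt p W ≤ cnt q W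
  cnt-mono p⇒q [] = ≤-refl
  cnt-mono {p} {q} p⇒q (v ∷ W) with p v in pv
  ... | false = ≤-trans (≤-reflexive (+-identityʳ _)) (m≤n⇒m≤n+o _ (cnt-mono p⇒q W))
  ... | true rewrite p⇒q v pv = +-mono-≤ (cnt-mono p⇒q W) (cnt-mono imp W)
    where
    imp : ∀ u → p u ∧ not (adj v u) ≡ true → q u ∧ not (adj v u) ≡ true
    imp u h with p u in pu | q u in qu
    ... | true | true = h
    ... | true | false = contradiction (≡-trans (sym qu) (p⇒q u pu)) λ ()
    imp u () | false | _

  count-filterᵇ : ∀ q W → count (filterᵇ q W) ≤ count W
  count-filterᵇ q W = ≤-trans (≤-reflexive (sym (cnt-filterᵇ (const true) q W))) (cnt-mono (λ _ _ → refl) W)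

  cnt≤2^ : ∀ p W → cnt p W ≤ 2 ^ length W
  cnt≤2^ p [] = ≤-refl
  cnt≤2^ p (v ∷ W) with p v
  ... | true = +-mono-≤ (cnt≤2^ p W) (m≤n⇒m≤n+o 0 (cnt≤2^ _ W))
  ... | false = +-mono-≤ (cnt≤2^ p W) z≤n

  Independent : List V → Set
  Independent = AllPairs (λ u v → adj u v ≡ false)

  independent? : ∀ W → (∃ λ u → ∃ λ v → ∃ λ W′ → W ↭ u ∷ v ∷ W′ × adj u v ≡ true) ⊎ Independent W
  independent? [] = inj₂ []
  independent? (x ∷ W) with extract (adj x) W | independent? W
  ... | inj₁ (v , W′ , W↭ , xv) | _ = inj₁ (x , v , W′ , prep x W↭ , xv)
  ... | inj₂ none | inj₂ ind = inj₂ (none ∷ ind)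
  ... | inj₂ _ | inj₁ (u , v , W′ , W↭ , uv) =
    inj₁ (u , v , x ∷ W′ , trans (prep x W↭) (↭-sym (shift x (u ∷ v ∷ []) W′)) , uv)

  count-independent : ∀ {W} → Independent W → count W ≡ 2 ^ length W
  count-independent [] = refl
  count-independent {v ∷ W} (none ∷ ind) = begin
    count (v ∷ W)                     ≡⟨ count-∷ v W ⟩
    count W + count (non-nbrs v W)    ≡⟨ cong (λ X → count W + count X) (filterᵇ-all _ W (All.map (cong not) none)) ⟩
    count W + count W                 ≡⟨ cong (λ k → k + k) (count-independent ind) ⟩
    2 ^ length W + 2 ^ length W       ≡⟨ cong (2 ^ length W +_) (sym (+-identityʳ _)) ⟩
    2 ^ suc (length W)                ∎
    where open ≡-Reasoning

  -- An independent set meets the edge `uv` in one of three ways, and each of them extends to at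
  -- most `count W′` sets. Compared with the four subsets of `{u, v}`, every edge saves a factor
  -- 3/4.
  count-edge : ∀ {u v W W′} → W ↭ u ∷ v ∷ W′ → adj u v ≡ true → count W ≤ 3 * count W′
  count-edge {u} {v} {W} {W′} W↭ uv = begin
    count W                                            ≡⟨ cnt-↭ W↭ _ ⟩
    count (u ∷ v ∷ W′)                                 ≡⟨ count-∷ u (v ∷ W′) ⟩
    count (v ∷ W′) + count (non-nbrs u (v ∷ W′))       ≡⟨ cong (count (v ∷ W′) +_) (cong count eq) ⟩
    count (v ∷ W′) + count (non-nbrs u W′)             ≡⟨ cong (_+ count (non-nbrs u W′)) (count-∷ v W′) ⟩
    count W′ + count (non-nbrs v W′) + count (non-nbrs u W′)
      ≤⟨ +-mono-≤ (+-monoʳ-≤ (count W′) (count-filterᵇ _ W′)) (count-filterᵇ _ W′) ⟩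
    count W′ + count W′ + count W′                     ≡⟨ lem (count W′) ⟩
    3 * count W′                                       ∎
    where
    open ≤-Reasoning
    lem : ∀ a → a + a + a ≡ 3 * a
    lem = solve-∀
    eq : non-nbrs u (v ∷ W′) ≡ non-nbrs u W′
    eq rewrite uv = refl

  count-mono-length : ∀ W {n} → length W ≤ n → count W ≤ 2 ^ n
  count-mono-length W W≤n = ≤-trans (cnt≤2^ _ W) (^-monoʳ-≤ 2 W≤n)

  -- Degrees within a list of vertices.

  deg-↭ : ∀ v {W W′} → W ↭ W′ → deg v W ≡ deg v W′
  deg-↭ v = length-filterᵇ-↭ (adj v)

  deg-++ : ∀ v W W′ → deg v (W ++ W′) ≡ deg v W + deg v W′
  deg-++ v = length-filterᵇ-++ (adj v)

  length-non-nbrs : ∀ v W → deg v W + length (non-nbrs v W) ≡ length W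
  length-non-nbrs v W = ≡-trans (sym (length-++ (nbrs v W))) (sym (↭-length (filterᵇ-partition (adj v) W)))

  deg-∷-false : ∀ {v u} W → adj v u ≡ false → deg v (u ∷ W) ≡ deg v W
  deg-∷-false W vu rewrite vu = refl

  deg-∷-true : ∀ {v u} W → adj v u ≡ true → deg v (u ∷ W) ≡ suc (deg v W)
  deg-∷-true W vu rewrite vu = refl

  deg-∷-≤ : ∀ v u W → deg v (u ∷ W) ≤ suc (deg v W)
  deg-∷-≤ v u W with adj v u
  ... | true = ≤-refl
  ... | false = n≤1+n _

  deg-none : ∀ v W → All (λ u → adj v u ≡ false) W → deg v W ≡ 0
  deg-none v W none = cong length (filterᵇ-none (adj v) W none)

  deg-all : ∀ v W → All (λ u → adj v u ≡ true) W → deg v W ≡ length W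
  deg-all v W all = cong length (filterᵇ-all (adj v) W all)

  deg-independent : ∀ {W} → Independent W → All (λ v → deg v W ≡ 0) W
  deg-independent [] = []
  deg-independent {v ∷ W} (none ∷ ind) =
    ≡-trans (deg-∷-false W (adj-irrefl v)) (deg-none v W none) ∷
    All.zipWith (λ (vu , du) → ≡-trans (deg-∷-false W (≡-trans (adj-sym _ v) vu)) du)
      (none , deg-independent ind)

  -- Upper bounds from an independent set, from a matching and from the non-neighbours of a vertex.

  -- Sort the sets by the first entry of `J` they contain. Its `δ` neighbours in `R` are excluded,
  -- so only the later entries of `J` and `r` vertices of `R` stay free. The resulting powers of two
  -- form a geometric sum `2^(|J| + r) − 2^r`; the sets avoiding `J` add at most `2^|R|`. Moving
  -- `2^r` to the left avoids subtraction.
  count-prefix : ∀ J R δ r → length R ≡ δ + r → Independent J → All (λ v → δ ≤ deg v R) J →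
    count (J ++ R) + 2 ^ r ≤ 2 ^ (length J + r) + 2 ^ length R
  count-prefix [] R δ r R≡ [] [] = begin
    count R + 2 ^ r        ≤⟨ +-monoˡ-≤ (2 ^ r) (cnt≤2^ _ R) ⟩
    2 ^ length R + 2 ^ r   ≡⟨ +-comm (2 ^ length R) _ ⟩
    2 ^ r + 2 ^ length R   ∎
    where open ≤-Reasoning
  count-prefix (v ∷ J) R δ r R≡ (_ ∷ ind) (δ≤ ∷ δ≤s) = begin
    count (v ∷ J ++ R) + 2 ^ r
      ≡⟨ cong (_+ 2 ^ r) (count-∷ v (J ++ R)) ⟩
    count (J ++ R) + count (non-nbrs v (J ++ R)) + 2 ^ r
      ≤⟨ +-monoˡ-≤ (2 ^ r) (+-monoʳ-≤ (count (J ++ R)) (count-mono-length (non-nbrs v (J ++ R)) few)) ⟩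
    count (J ++ R) + 2 ^ (length J + r) + 2 ^ r
      ≡⟨ shuffle (count (J ++ R)) _ _ ⟩
    count (J ++ R) + 2 ^ r + 2 ^ (length J + r)
      ≤⟨ +-monoˡ-≤ _ (count-prefix J R δ r R≡ ind δ≤s) ⟩
    2 ^ (length J + r) + 2 ^ length R + 2 ^ (length J + r)
      ≡⟨ double (2 ^ (length J + r)) _ ⟩
    2 ^ (suc (length J) + r) + 2 ^ length R ∎
    where
    open ≤-Reasoning
    shuffle : ∀ a b c → a + b + c ≡ a + c + b
    shuffle = solve-∀
    double : ∀ a b → a + b + a ≡ 2 * a + b
    double = solve-∀
    rearrange : ∀ a δ r → a + (δ + r) ≡ δ + (a + r)
    rearrange = solve-∀
    few : length (non-nbrs v (J ++ R)) ≤ length J + r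
    few = +-cancelˡ-≤ δ _ _ (begin
      δ + length (non-nbrs v (J ++ R))
        ≤⟨ +-monoˡ-≤ _ (≤-trans δ≤ (≤-trans (m≤n+m _ (deg v J)) (≤-reflexive (sym (deg-++ v J R))))) ⟩
      deg v (J ++ R) + length (non-nbrs v (J ++ R)) ≡⟨ length-non-nbrs v (J ++ R) ⟩
      length (J ++ R)      ≡⟨ length-++ J ⟩
      length J + length R  ≡⟨ cong (length J +_) R≡ ⟩
      length J + (δ + r)   ≡⟨ rearrange (length J) δ r ⟩
      δ + (length J + r)   ∎)

  -- Remove disjoint edges greedily. If this stops before `m` edges are found, at most `m − 1` have
  -- been removed, so at least `|W| − 2(m − 1) ≥ s` vertices are left and they are independent; this
  -- is where the `2 +` comes from. Otherwise each of the `m` edges contributes the factor 3/4.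
  independent-or-matching : ∀ m s W → s + 2 * m ≤ 2 + length W →
    (∃₂ λ J R → W ↭ J ++ R × Independent J × length J ≡ s) ⊎ 4 ^ m * count W ≤ 3 ^ m * 2 ^ length W
  independent-or-matching zero s W _ = inj₂ (*-monoʳ-≤ 1 (cnt≤2^ _ W))
  independent-or-matching (suc m) s W s+2m≤ with independent? W
  ... | inj₂ ind = inj₁ (take s W , drop s W , ↭-reflexive (sym (take++drop≡id s W)) ,
    AllPairs.take⁺ s ind , ≡-trans (length-take s W) (m≤n⇒m⊓n≡m s≤))
    where
    s≤ : s ≤ length W
    s≤ = +-cancelˡ-≤ 2 _ _ (≤-trans (≤-trans (m≤m+n (2 + s) (2 * m)) (≤-reflexive (eq s m))) s+2m≤)
      where
      eq : ∀ s m → 2 + s + 2 * m ≡ s + 2 * suc m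
      eq = solve-∀
  ... | inj₁ (u , v , W′ , W↭ , uv) with independent-or-matching m s W′ s+2m≤′
    where
    eq : ∀ s m → 2 + (s + 2 * m) ≡ s + 2 * suc m
    eq = solve-∀
    s+2m≤′ : s + 2 * m ≤ 2 + length W′
    s+2m≤′ = +-cancelˡ-≤ 2 _ _ (≤-trans (≤-reflexive (eq s m))
      (≤-trans s+2m≤ (≤-reflexive (cong (2 +_) (↭-length W↭)))))
  ... | inj₁ (J , R , W′↭ , ind , J≡) =
    inj₁ (J , u ∷ v ∷ R , trans W↭ (trans (prep u (prep v W′↭)) (↭-sym (shifts J (u ∷ v ∷ [])))) , ind , J≡)
  ... | inj₂ bound = inj₂ (begin
    4 ^ suc m * count W                  ≤⟨ *-monoʳ-≤ (4 ^ suc m) (count-edge W↭ uv) ⟩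
    4 ^ suc m * (3 * count W′)           ≡⟨ eq₁ (4 ^ m) (count W′) ⟩
    12 * (4 ^ m * count W′)              ≤⟨ *-monoʳ-≤ 12 bound ⟩
    12 * (3 ^ m * 2 ^ length W′)         ≡⟨ eq₂ (3 ^ m) (2 ^ length W′) ⟩
    3 ^ suc m * 2 ^ (2 + length W′)      ≡⟨ cong (λ k → 3 ^ suc m * 2 ^ k) (sym (↭-length W↭)) ⟩
    3 ^ suc m * 2 ^ length W             ∎)
    where
    open ≤-Reasoning
    eq₁ : ∀ x c → 4 * x * (3 * c) ≡ 12 * (x * c)
    eq₁ = solve-∀
    eq₂ : ∀ x y → 12 * (x * y) ≡ 3 * x * (2 * (2 * y))
    eq₂ = solve-∀

  -- With `δ = suc d`: if `v` has more than `δ` neighbours, at most `s − 1` vertices remain, which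
  -- gives even the factor 1/2. If it has exactly `δ`, then `s` vertices remain, and an edge among
  -- them gives 3/4.
  count-non-nbrs : ∀ d s v W → length W ≡ suc d + s →
    All (λ x → suc d ≤ deg x (v ∷ W)) (v ∷ W) → All (λ x → deg x (v ∷ W) ≤ s) (v ∷ W) →
    4 * count (non-nbrs v W) ≤ 3 * 2 ^ s
  count-non-nbrs d s v W W≡ (δ≤v ∷ δ≤) (_ ∷ ≤s) with suc d <? deg v W
  ... | yes δ<v = begin
    4 * count Z          ≡⟨ eq₁ (count Z) ⟩
    2 * (2 * count Z)    ≤⟨ *-monoʳ-≤ 2 (*-monoʳ-≤ 2 (cnt≤2^ _ Z)) ⟩
    2 * 2 ^ suc (length Z) ≤⟨ *-monoʳ-≤ 2 (^-monoʳ-≤ 2 Z<s) ⟩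
    2 * 2 ^ s            ≤⟨ *-monoˡ-≤ (2 ^ s) (n≤1+n 2) ⟩
    3 * 2 ^ s            ∎
    where
    open ≤-Reasoning
    Z = non-nbrs v W
    eq₁ : ∀ x → 4 * x ≡ 2 * (2 * x)
    eq₁ = solve-∀
    Z<s : length Z < s
    Z<s = +-cancelˡ-≤ (suc d) _ _ (begin
      suc d + suc (length Z)  ≡⟨ +-suc (suc d) _ ⟩
      suc (suc d) + length Z  ≤⟨ +-monoˡ-≤ _ δ<v ⟩
      deg v W + length Z      ≡⟨ length-non-nbrs v W ⟩
      length W                ≡⟨ W≡ ⟩
      suc d + s               ∎)
  ... | no δ≮v = with-edge (independent? Z)
    where
    open ≤-Reasoning
    N = nbrs v W
    Z = non-nbrs v W
    v≡ : deg v W ≡ suc d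
    v≡ = ≤-antisym (≮⇒≥ δ≮v) (≤-trans δ≤v (≤-reflexive (deg-∷-false W (adj-irrefl v))))
    Z≡ : length Z ≡ s
    Z≡ = +-cancelˡ-≡ (suc d) _ _ (≡-trans (cong (_+ length Z) (sym v≡)) (≡-trans (length-non-nbrs v W) W≡))
    W↭ : W ↭ N ++ Z
    W↭ = filterᵇ-partition (adj v) W
    eq₂ : ∀ x → 4 * (3 * x) ≡ 3 * (2 * (2 * x))
    eq₂ = solve-∀
    -- If Z is independent then each vertex of v ∷ Z has all its δ neighbours in N, so it is
    -- adjacent to all of N; any u in N then has degree more than s.
    impossible : Independent Z → ∀ N → W ↭ N ++ Z → length N ≡ suc d →
      All (λ u → adj v u ≡ true) N → All (λ z → adj v z ≡ false) Z → suc s ≤ s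
    impossible ind (u ∷ N) W↭ N≡ (vu ∷ _) vZ = begin
      suc s                  ≡⟨ cong suc (sym Z≡) ⟩
      length (v ∷ Z)         ≡⟨ sym (deg-all u (v ∷ Z) (≡-trans (adj-sym u v) vu ∷ uZ)) ⟩
      deg u (v ∷ Z)          ≤⟨ m≤n+m _ (deg u (u ∷ N)) ⟩
      deg u (u ∷ N) + deg u (v ∷ Z) ≡⟨ sym (deg-++ u (u ∷ N) (v ∷ Z)) ⟩
      deg u (u ∷ N ++ v ∷ Z) ≡⟨ deg-↭ u (trans (shift v (u ∷ N) Z) (prep v (↭-sym W↭))) ⟩
      deg u (v ∷ W)          ≤⟨ All.head (All-resp-↭ W↭ ≤s) ⟩
      s                      ∎
      where
      adjacent : ∀ {z} → adj v z ≡ false → deg z Z ≡ 0 → suc d ≤ deg z (v ∷ W) → adj u z ≡ true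
      adjacent {z} vz dz δ≤z = ≡-trans (adj-sym u z) (All.head (filterᵇ-full (adj z) (u ∷ N) (begin
        suc (length N)           ≡⟨ N≡ ⟩
        suc d                    ≤⟨ δ≤z ⟩
        deg z (v ∷ W)            ≡⟨ deg-∷-false W (≡-trans (adj-sym z v) vz) ⟩
        deg z W                  ≡⟨ deg-↭ z W↭ ⟩
        deg z (u ∷ N ++ Z)       ≡⟨ deg-++ z (u ∷ N) Z ⟩
        deg z (u ∷ N) + deg z Z  ≡⟨ cong (deg z (u ∷ N) +_) dz ⟩
        deg z (u ∷ N) + 0        ≡⟨ +-identityʳ _ ⟩
        deg z (u ∷ N)            ∎)))
      uZ : All (λ z → adj u z ≡ true) Z
      uZ = All.zipWith (λ (vz , dz , δ≤z) → adjacent vz dz δ≤z)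
        (vZ , All.zip (deg-independent ind , All.++⁻ʳ (u ∷ N) (All-resp-↭ W↭ δ≤)))
    with-edge : _ → 4 * count Z ≤ 3 * 2 ^ s
    with-edge (inj₁ (u , w , Z′ , Z↭ , uw)) = begin
      4 * count Z              ≤⟨ *-monoʳ-≤ 4 (count-edge Z↭ uw) ⟩
      4 * (3 * count Z′)       ≤⟨ *-monoʳ-≤ 4 (*-monoʳ-≤ 3 (cnt≤2^ _ Z′)) ⟩
      4 * (3 * 2 ^ length Z′)  ≡⟨ eq₂ (2 ^ length Z′) ⟩
      3 * 2 ^ (2 + length Z′)  ≡⟨ cong (λ k → 3 * 2 ^ k) (≡-trans (sym (↭-length Z↭)) Z≡) ⟩
      3 * 2 ^ s                ∎
    with-edge (inj₂ ind) = contradiction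
      (impossible ind N W↭ v≡ (filterᵇ-satisfies (adj v) W)
        (All.map not-injective (filterᵇ-satisfies (λ u → not (adj v u)) W))) 1+n≰n

  -- Complete bipartite graphs and the induction on the minimum degree.

  CompleteBipartite : ℕ → List V → Set
  CompleteBipartite d W = ∃₂ λ A B → W ↭ A ++ B × length A ≡ d ×
    Independent A × Independent B × All (λ a → All (λ b → adj a b ≡ true) B) A

  -- An independent set lies inside `A` or inside `B`, and the empty set lies in both, whence the
  -- `+ 1`. In the induction, choosing `a` leaves exactly the rest of `A`.
  count-completeBipartite : ∀ A B → Independent A → Independent B →
    All (λ a → All (λ b → adj a b ≡ true) B) A → count (A ++ B) + 1 ≡ 2 ^ length B + 2 ^ length A
  count-completeBipartite [] B [] indB [] = cong (_+ 1) (count-independent indB)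
  count-completeBipartite (a ∷ A) B (none ∷ indA) indB (aB ∷ AB) = begin
    count (a ∷ A ++ B) + 1                    ≡⟨ cong (_+ 1) (count-∷ a (A ++ B)) ⟩
    count (A ++ B) + count (non-nbrs a (A ++ B)) + 1
      ≡⟨ cong (λ W → count (A ++ B) + count W + 1) only-A ⟩
    count (A ++ B) + count A + 1              ≡⟨ shuffle (count (A ++ B)) _ ⟩
    count (A ++ B) + 1 + count A
      ≡⟨ cong₂ _+_ (count-completeBipartite A B indA indB AB) (count-independent indA) ⟩
    2 ^ length B + 2 ^ length A + 2 ^ length A ≡⟨ double (2 ^ length B) _ ⟩
    2 ^ length B + 2 ^ suc (length A)         ∎
    where
    open ≡-Reasoning
    shuffle : ∀ x y → x + y + 1 ≡ x + 1 + y
    shuffle = solve-∀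
    double : ∀ x y → x + y + y ≡ x + 2 * y
    double = solve-∀
    only-A : non-nbrs a (A ++ B) ≡ A
    only-A = begin
      non-nbrs a (A ++ B)            ≡⟨ filter-++ _ A B ⟩
      non-nbrs a A ++ non-nbrs a B
        ≡⟨ cong₂ _++_ (filterᵇ-all _ A (All.map (cong not) none)) (filterᵇ-none _ B (All.map (cong not) aB)) ⟩
      A ++ []                        ≡⟨ ++-identityʳ A ⟩
      A                              ∎

  -- Here `δ` is `suc d` and `n − δ` is `suc q`, so the last hypothesis says that no vertex has
  -- degree `n − δ` or more.
  count-no-large-degree : ∀ d q W → length W ≡ suc d + suc q → 6 * suc d + 1 ≤ suc q →
    All (λ v → suc d ≤ deg v W) W → All (λ v → deg v W ≤ q) W → count W ≤ 2 ^ suc q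
  -- Asking for `3δ` edges or `δ + 3` independent vertices takes `δ + 3 + 6δ ≤ 2 + n`, that is
  -- `n ≥ 7δ + 1`.
  count-no-large-degree d q W W≡ 6δ<q δ≤ ≤q with independent-or-matching (3 * suc d) (suc d + 3) W size
    where
    size : suc d + 3 + 2 * (3 * suc d) ≤ 2 + length W
    size = begin
      suc d + 3 + 2 * (3 * suc d)    ≡⟨ eq (suc d) ⟩
      2 + (suc d + (6 * suc d + 1))  ≤⟨ +-monoʳ-≤ 2 (+-monoʳ-≤ (suc d) 6δ<q) ⟩
      2 + (suc d + suc q)            ≡⟨ cong (2 +_) (sym W≡) ⟩
      2 + length W                   ∎
      where
      open ≤-Reasoning
      eq : ∀ δ → δ + 3 + 2 * (3 * δ) ≡ 2 + (δ + (6 * δ + 1))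
      eq = solve-∀
  ... | inj₂ bound = *-cancelˡ-≤ (64 ^ suc d) {{m^n≢0 64 (suc d)}} (begin
    64 ^ suc d * count W                        ≡⟨ cong (_* count W) (^-*-assoc 4 3 (suc d)) ⟩
    4 ^ (3 * suc d) * count W                   ≤⟨ bound ⟩
    3 ^ (3 * suc d) * 2 ^ length W
      ≡⟨ cong₂ _*_ (sym (^-*-assoc 3 3 (suc d))) (≡-trans (cong (2 ^_) W≡) (^-distribˡ-+-* 2 (suc d) (suc q))) ⟩
    27 ^ suc d * (2 ^ suc d * 2 ^ suc q)        ≡⟨ sym (*-assoc (27 ^ suc d) _ _) ⟩
    27 ^ suc d * 2 ^ suc d * 2 ^ suc q          ≡⟨ cong (_* 2 ^ suc q) (sym (^-distribʳ-* (suc d) 27 2)) ⟩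
    -- The surplus `2^δ` is absorbed by the matching since `2 · 27 ≤ 64`.
    54 ^ suc d * 2 ^ suc q                      ≤⟨ *-monoˡ-≤ (2 ^ suc q) (^-monoˡ-≤ (suc d) (m≤m+n 54 10)) ⟩
    64 ^ suc d * 2 ^ suc q                      ∎)
    where
    open ≤-Reasoning
    ^-distribʳ-* : ∀ n a b → (a * b) ^ n ≡ a ^ n * b ^ n
    ^-distribʳ-* zero a b = refl
    ^-distribʳ-* (suc n) a b = ≡-trans (cong (a * b *_) (^-distribʳ-* n a b)) (eq a b (a ^ n) (b ^ n))
      where
      eq : ∀ a b x y → a * b * (x * y) ≡ a * x * (b * y)
      eq = solve-∀
  ... | inj₁ (v ∷ J , R , W↭ , none ∷ ind , J≡) = ≤-trans (≤-reflexive (cnt-↭ W↭ _)) (*-cancelˡ-≤ 4 (begin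
      4 * count (v ∷ J ++ R)
        ≡⟨ cong (4 *_) (count-∷ v (J ++ R)) ⟩
      4 * (count (J ++ R) + count (non-nbrs v (J ++ R)))
        ≤⟨ *-monoʳ-≤ 4 (+-monoˡ-≤ _ (m≤m+n (count (J ++ R)) (2 ^ r))) ⟩
      4 * (count (J ++ R) + 2 ^ r + count (non-nbrs v (J ++ R)))
        ≡⟨ *-distribˡ-+ 4 (count (J ++ R) + 2 ^ r) _ ⟩
      4 * (count (J ++ R) + 2 ^ r) + 4 * count (non-nbrs v (J ++ R))
        ≤⟨ +-mono-≤ (*-monoʳ-≤ 4 (count-prefix J R (suc d) r R≡ ind (All.tail δ≤R)))
             (count-non-nbrs d q v (J ++ R) JR≡ (All-resp-↭ W↭ δ≤′) (All-resp-↭ W↭ ≤q′)) ⟩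
      4 * (2 ^ (length J + r) + 2 ^ length R) + 3 * 2 ^ q
        ≡⟨ cong₂ (λ x y → 4 * (2 ^ x + 2 ^ length R) + 3 * 2 ^ y) J+r≡ q≡ ⟩
      -- With `x = 2^|R|`, the sets without `v` number at most `5x` and those with `v` at most `3x`,
      -- which adds up to exactly `8x = 2^(q + 1)`. Without the factor 3/4 the second bound would be
      -- `4x`, one `x` too many.
      4 * (2 ^ (2 + length R) + 2 ^ length R) + 3 * 2 ^ (2 + length R)
        ≡⟨ eq₁ (2 ^ length R) ⟩
      4 * 2 ^ (3 + length R)
        ≡⟨ cong (λ k → 4 * 2 ^ suc k) (sym q≡) ⟩
      4 * 2 ^ suc q ∎))
    where
    open ≤-Reasoning
    -- No truncation occurs: `v` has its `δ` neighbours in `R`, as it has none in `v ∷ J`.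
    r = length R ∸ suc d
    eq₁ : ∀ x → 4 * (2 * (2 * x) + x) + 3 * (2 * (2 * x)) ≡ 4 * (2 * (2 * (2 * x)))
    eq₁ = solve-∀
    δ≤′ : All (λ x → suc d ≤ deg x (v ∷ J ++ R)) W
    δ≤′ = All.map (λ {x} h → ≤-trans h (≤-reflexive (deg-↭ x W↭))) δ≤
    ≤q′ : All (λ x → deg x (v ∷ J ++ R) ≤ q) W
    ≤q′ = All.map (λ {x} h → ≤-trans (≤-reflexive (deg-↭ x (↭-sym W↭))) h) ≤q
    δ≤R : All (λ x → suc d ≤ deg x R) (v ∷ J)
    δ≤R = All.zipWith (λ {x} (dx , h) → ≤-trans h (≤-reflexive (≡-trans (deg-++ x (v ∷ J) R) (cong (_+ deg x R) dx))))
      (deg-independent (none ∷ ind) , All.++⁻ˡ (v ∷ J) (All-resp-↭ W↭ δ≤′))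
    R≡ : length R ≡ suc d + r
    R≡ = sym (m+[n∸m]≡n (≤-trans (All.head δ≤R) (length-filter _ R)))
    J≡′ : length J ≡ 2 + suc d
    J≡′ = suc-injective (≡-trans J≡ (+-comm (suc d) 3))
    J+r≡ : length J + r ≡ 2 + length R
    J+r≡ = ≡-trans (cong (_+ r) J≡′) (cong (2 +_) (sym R≡))
    q≡ : q ≡ 2 + length R
    q≡ = +-cancelˡ-≡ (suc (suc d)) _ _ (≡-trans (sym (+-suc (suc d) q)) (≡-trans (sym W≡) (≡-trans (↭-length W↭)
      (≡-trans (cong suc (length-++ J)) (≡-trans (cong (λ k → suc (k + length R)) J≡′) (eq₂ d (length R)))))))
      where
      eq₂ : ∀ d r → suc (2 + suc d + r) ≡ suc (suc d) + (2 + r)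
      eq₂ = solve-∀
    JR≡ : length (J ++ R) ≡ suc d + q
    JR≡ = suc-injective (≡-trans (sym (↭-length W↭)) (≡-trans W≡ (+-suc (suc d) q)))

  -- At most `d` vertices are not adjacent to `v`, so at most `2^d` sets contain `v`, exactly the
  -- growth of the right-hand side. If `W` is already complete bipartite, each vertex of `B` has
  -- only `d` neighbours in `W` and so must be adjacent to `v`. Then `v` either joins `A`, or has a
  -- neighbour in `A` and hence fewer than `d` non-neighbours, which makes the bound strict.
  bipartite-or-few-∷ : ∀ d q v W → length W ≡ d + q → q ≤ deg v W →
    All (λ x → suc d ≤ deg x (v ∷ W)) W →
    CompleteBipartite d W ⊎ count W + 1 < 2 ^ q + 2 ^ d →
    CompleteBipartite (suc d) (v ∷ W) ⊎ count (v ∷ W) + 1 < 2 ^ q + 2 ^ suc d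
  bipartite-or-few-∷ d q v W W≡ q≤v δ≤ = step
    where
    open ≤-Reasoning
    expand : count (v ∷ W) + 1 ≡ count W + 1 + count (non-nbrs v W)
    expand = ≡-trans (cong (_+ 1) (count-∷ v W)) (eq (count W) _)
      where
      eq : ∀ x y → x + y + 1 ≡ x + 1 + y
      eq = solve-∀
    double : 2 ^ q + 2 ^ d + 2 ^ d ≡ 2 ^ q + 2 ^ suc d
    double = eq (2 ^ q) (2 ^ d)
      where
      eq : ∀ x y → x + y + y ≡ x + 2 * y
      eq = solve-∀
    -- Used with `k = 0` for the plain bound and with `k = 1` when `v` also has a neighbour in `A`.
    non-nbrs+k≤d : ∀ {k} → k + q ≤ deg v W → length (non-nbrs v W) + k ≤ d
    non-nbrs+k≤d {k} h = +-cancelʳ-≤ q _ _ (begin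
      length (non-nbrs v W) + k + q    ≡⟨ +-assoc _ k q ⟩
      length (non-nbrs v W) + (k + q)  ≤⟨ +-monoʳ-≤ _ h ⟩
      length (non-nbrs v W) + deg v W  ≡⟨ +-comm _ (deg v W) ⟩
      deg v W + length (non-nbrs v W)  ≡⟨ length-non-nbrs v W ⟩
      length W                         ≡⟨ W≡ ⟩
      d + q                            ∎)
    complete-B : ∀ {A B} → length A ≡ d → W ↭ A ++ B → Independent B → All (λ b → adj v b ≡ true) B
    complete-B {A} {B} A≡ W↭ indB = All.zipWith (λ (db , h) → adjacent db h)
      (deg-independent indB , All.++⁻ʳ A (All-resp-↭ W↭ δ≤))
      where
      adjacent : ∀ {b} → deg b B ≡ 0 → suc d ≤ deg b (v ∷ W) → adj v b ≡ true
      adjacent {b} db h with adj v b in vb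
      ... | true = refl
      ... | false = contradiction (begin
        suc d              ≤⟨ h ⟩
        deg b (v ∷ W)      ≡⟨ deg-∷-false W (≡-trans (adj-sym b v) vb) ⟩
        deg b W            ≡⟨ deg-↭ b W↭ ⟩
        deg b (A ++ B)     ≡⟨ deg-++ b A B ⟩
        deg b A + deg b B  ≤⟨ +-mono-≤ (length-filter (T? ∘ adj b) A) (≤-reflexive db) ⟩
        length A + 0       ≡⟨ ≡-trans (+-identityʳ _) A≡ ⟩
        d                  ∎) 1+n≰n
    step : _ → _
    step (inj₂ few) = inj₂ (begin-strict
      count (v ∷ W) + 1                   ≡⟨ expand ⟩
      count W + 1 + count (non-nbrs v W)
        <⟨ +-mono-<-≤ few (count-mono-length (non-nbrs v W) (m+n≤o⇒m≤o _ (non-nbrs+k≤d {0} q≤v))) ⟩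
      2 ^ q + 2 ^ d + 2 ^ d               ≡⟨ double ⟩
      2 ^ q + 2 ^ suc d                   ∎)
    step (inj₁ (A , B , W↭ , A≡ , indA , indB , AB)) with extract (adj v) A
    ... | inj₂ none = inj₁ (v ∷ A , B , prep v W↭ , cong suc A≡ , none ∷ indA , indB , complete-B A≡ W↭ indB ∷ AB)
    ... | inj₁ (a , A′ , A↭ , va) = inj₂ (begin-strict
      count (v ∷ W) + 1                   ≡⟨ expand ⟩
      count W + 1 + count (non-nbrs v W)
        <⟨ +-mono-≤-< (≤-reflexive countW) (≤-<-trans (cnt≤2^ _ (non-nbrs v W)) (^-monoʳ-< 2 ≤-refl few)) ⟩
      2 ^ q + 2 ^ d + 2 ^ d               ≡⟨ double ⟩
      2 ^ q + 2 ^ suc d                   ∎)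
      where
      B≡ : length B ≡ q
      B≡ = +-cancelˡ-≡ d _ _ (≡-trans (cong (_+ length B) (sym A≡))
        (≡-trans (sym (length-++ A)) (≡-trans (sym (↭-length W↭)) W≡)))
      countW : count W + 1 ≡ 2 ^ q + 2 ^ d
      countW = ≡-trans (cong (_+ 1) (cnt-↭ W↭ _)) (≡-trans (count-completeBipartite A B indA indB AB)
        (cong₂ (λ k l → 2 ^ k + 2 ^ l) B≡ A≡))
      few : length (non-nbrs v W) < d
      few = ≤-trans (≤-reflexive (+-comm 1 _)) (non-nbrs+k≤d {1} (begin
        1 + q              ≡⟨ cong suc (sym (≡-trans (deg-all v B (complete-B A≡ W↭ indB)) B≡)) ⟩
        1 + deg v B        ≤⟨ +-monoˡ-≤ (deg v B) v-in-A ⟩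
        deg v A + deg v B  ≡⟨ sym (≡-trans (deg-↭ v W↭) (deg-++ v A B)) ⟩
        deg v W            ∎))
        where
        v-in-A : 1 ≤ deg v A
        v-in-A = ≤-trans (s≤s z≤n) (≤-reflexive (sym (≡-trans (deg-↭ v A↭) (deg-∷-true A′ va))))

  -- Induction on `d` with `q` fixed: deleting one vertex lowers every other degree by at most one,
  -- and the size hypothesis only becomes weaker.
  bipartite-or-few : ∀ d q W → length W ≡ d + q → 6 * d + 1 ≤ q → All (λ v → d ≤ deg v W) W →
    CompleteBipartite d W ⊎ count W + 1 < 2 ^ q + 2 ^ d
  bipartite-or-few zero q W W≡ _ _ with independent? W
  ... | inj₂ ind = inj₁ ([] , W , refl , refl , [] , ind , [])
  -- Since `2 ^ 0 = 1`, both sides carry a `1`, and a single edge already forces `count W < 2 ^ q`.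
  ... | inj₁ (u , v , W′ , W↭ , uv) = inj₂ (+-monoˡ-< 1 (begin-strict
    count W             ≤⟨ count-edge W↭ uv ⟩
    3 * count W′        ≤⟨ *-monoʳ-≤ 3 (cnt≤2^ _ W′) ⟩
    3 * 2 ^ length W′   <⟨ *-monoˡ-< (2 ^ length W′) {{m^n≢0 2 (length W′)}} (n<1+n 3) ⟩
    4 * 2 ^ length W′   ≡⟨ *-assoc 2 2 (2 ^ length W′) ⟩
    2 ^ (2 + length W′) ≡⟨ cong (2 ^_) (≡-trans (sym (↭-length W↭)) W≡) ⟩
    2 ^ q               ∎))
    where open ≤-Reasoning
  bipartite-or-few (suc d) zero W W≡ () _
  bipartite-or-few (suc d) (suc q) W W≡ size δ≤ with extract (λ v → suc q ≤ᵇ deg v W) W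
  ... | inj₂ none = inj₂ (begin-strict
    count W + 1           ≤⟨ +-monoˡ-≤ 1 (count-no-large-degree d q W W≡ size δ≤ (All.map small none)) ⟩
    2 ^ suc q + 1         <⟨ +-monoʳ-< (2 ^ suc q) (*-monoʳ-≤ 2 (m^n>0 2 d)) ⟩
    2 ^ suc q + 2 ^ suc d ∎)
    where
    open ≤-Reasoning
    small : ∀ {v} → (suc q ≤ᵇ deg v W) ≡ false → deg v W ≤ q
    small h = s≤s⁻¹ (≰⇒> (λ le → subst T h (≤⇒≤ᵇ le)))
  ... | inj₁ (v , W′ , W↭ , big) = Sum.map
    (λ (A , B , v∷W′↭ , rest) → A , B , trans W↭ v∷W′↭ , rest)
    (subst (λ k → k + 1 < 2 ^ suc q + 2 ^ suc d) (sym (cnt-↭ W↭ _)))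
    (bipartite-or-few-∷ d (suc q) v W′ W′≡ v-large (All.tail δ≤′)
      (bipartite-or-few d (suc q) W′ W′≡ size′
        (All.map (λ {x} h → s≤s⁻¹ (≤-trans h (deg-∷-≤ x v W′))) (All.tail δ≤′))))
    where
    W′≡ : length W′ ≡ d + suc q
    W′≡ = suc-injective (≡-trans (sym (↭-length W↭)) W≡)
    size′ : 6 * d + 1 ≤ suc q
    size′ = ≤-trans (+-monoˡ-≤ 1 (*-monoʳ-≤ 6 (n≤1+n d))) size
    v-large : suc q ≤ deg v W′
    v-large = ≤-trans (≤ᵇ⇒≤ _ _ (subst T (sym big) _))
      (≤-reflexive (≡-trans (deg-↭ v W↭) (deg-∷-false W′ (adj-irrefl v))))
    δ≤′ : All (λ x → suc d ≤ deg x (v ∷ W′)) (v ∷ W′)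
    δ≤′ = All.map (λ {x} h → ≤-trans h (≤-reflexive (deg-↭ x W↭))) (All-resp-↭ W↭ δ≤)

-- Partial sums of the exponential series and the size condition.

-- The first two terms of the binomial expansion of `(a + 1)^(k + 1)`.
suc^-lower-bound : ∀ a k → a ^ suc k + suc k * a ^ k ≤ suc a ^ suc k
suc^-lower-bound a zero = ≤-reflexive (eq a)
  where
  eq : ∀ a → a * 1 + 1 * 1 ≡ suc a * 1
  eq = solve-∀
suc^-lower-bound a (suc k) = begin
  a ^ (2 + k) + (2 + k) * a ^ suc k                     ≤⟨ m≤m+n _ (suc k * a ^ k) ⟩
  a ^ (2 + k) + (2 + k) * a ^ suc k + suc k * a ^ k     ≡⟨ eq a k (a ^ k) ⟩
  suc a * (a ^ suc k + suc k * a ^ k)                   ≤⟨ *-monoʳ-≤ (suc a) (suc^-lower-bound a k) ⟩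
  suc a ^ (2 + k)                                       ∎
  where
  open ≤-Reasoning
  eq : ∀ a k x → a * (a * x) + (2 + k) * (a * x) + suc k * x ≡ suc a * (a * x + suc k * x)
  eq = solve-∀

-- Write `E_N(a)` for the sum of `a^k / k!` over `k ≤ N`. After division by `(N + 1)!` this reads
-- `E_(N+1)(a) + E_N(a) ≤ E_(N+1)(a + 1)`, which is the binomial bound summed term by term.
expS-suc : ∀ a N → expS a (suc N) + suc N * expS a N ≤ expS (suc a) (suc N)
expS-suc a zero = ≤-reflexive (eq a)
  where
  eq : ∀ a → 1 * 1 + a * 1 + 1 * 1 ≡ 1 * 1 + suc a * 1
  eq = solve-∀
expS-suc a (suc N) = begin
  (2 + N) * expS a (suc N) + a ^ (2 + N) + (2 + N) * (suc N * expS a N + a ^ suc N)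
    ≡⟨ eq N (expS a (suc N)) (a ^ (2 + N)) (expS a N) (a ^ suc N) ⟩
  (2 + N) * (expS a (suc N) + suc N * expS a N) + (a ^ (2 + N) + (2 + N) * a ^ suc N)
    ≤⟨ +-mono-≤ (*-monoʳ-≤ (2 + N) (expS-suc a N)) (suc^-lower-bound a (suc N)) ⟩
  (2 + N) * expS (suc a) (suc N) + suc a ^ (2 + N) ∎
  where
  open ≤-Reasoning
  eq : ∀ N x y z w → (2 + N) * x + y + (2 + N) * (suc N * z + w) ≡ (2 + N) * (x + suc N * z) + (y + (2 + N) * w)
  eq = solve-∀

2^a*a!≤expS : ∀ a → 2 ^ a * a ! ≤ expS a a
2^a*a!≤expS zero = ≤-refl
2^a*a!≤expS (suc a) = begin
  2 ^ suc a * (suc a) !                    ≡⟨ eq (2 ^ a) a (a !) ⟩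
  suc a * (2 ^ a * a !) + suc a * (2 ^ a * a !)
    ≤⟨ +-mono-≤ (*-monoʳ-≤ (suc a) (2^a*a!≤expS a)) (*-monoʳ-≤ (suc a) (2^a*a!≤expS a)) ⟩
  suc a * expS a a + suc a * expS a a      ≤⟨ +-monoˡ-≤ (suc a * expS a a) (m≤m+n (suc a * expS a a) (a ^ suc a)) ⟩
  expS a (suc a) + suc a * expS a a        ≤⟨ expS-suc a a ⟩
  expS (suc a) (suc a)                     ∎
  where
  open ≤-Reasoning
  eq : ∀ x a f → 2 * x * (suc a * f) ≡ suc a * (x * f) + suc a * (x * f)
  eq = solve-∀

Ln4TimesGE⇒≤ : ∀ b a → Ln4TimesGE b a → a ≤ 2 * b
Ln4TimesGE⇒≤ b a h = ≮⇒≥ λ 2b<a → <⇒≱ (^-monoʳ-< 2 ≤-refl 2b<a) (begin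
  -- The partial sum up to `N = a` is already at least `2^a`.
  2 ^ a         ≤⟨ *-cancelʳ-≤ _ _ (a !) {{a !≢0}} (≤-trans (2^a*a!≤expS a) (h a)) ⟩
  4 ^ b         ≡⟨ ^-*-assoc 2 2 b ⟩
  2 ^ (2 * b)   ∎)
  where open ≤-Reasoning

-- Put `m = n − 2δ − 2`. Replacing `ln 4` by the bound just shown gives `δ² + 3δ + m ≤ 2m`, so
-- `q = δ + 2 + m ≥ δ² + 4δ + 2`, and this exceeds `6δ + 1` by `(δ − 1)²`.
sizeCondition⇒ : ∀ n δ → SizeCondition n δ → ∃ λ q → n ≡ δ + q × 6 * δ + 1 ≤ q
sizeCondition⇒ n δ (2δ+2≤n , h) with m≤n⇒∃[o]m+o≡n 2δ+2≤n
... | m , refl = δ + 2 + m , eq₁ δ m , (begin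
  6 * δ + 1                   ≤⟨ square δ ⟩
  δ + 2 + (δ * δ + 3 * δ)     ≤⟨ +-monoʳ-≤ (δ + 2) δ²+3δ≤m ⟩
  δ + 2 + m                   ∎)
  where
  open ≤-Reasoning
  eq₁ : ∀ δ m → 2 * δ + 2 + m ≡ δ + (δ + 2 + m)
  eq₁ = solve-∀
  eq₂ : ∀ δ m → 2 * δ + 2 + m ≡ 2 + (2 * δ + m)
  eq₂ = solve-∀
  eq₃ : ∀ δ m → δ * δ + 3 * δ + m ≡ δ * δ + δ + (2 * δ + m)
  eq₃ = solve-∀
  eq₄ : ∀ e → 6 * suc e + 1 + e * e ≡ suc e + 2 + (suc e * suc e + 3 * suc e)
  eq₄ = solve-∀
  square : ∀ δ → 6 * δ + 1 ≤ δ + 2 + (δ * δ + 3 * δ)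
  square zero = s≤s z≤n
  square (suc e) = ≤-trans (m≤m+n _ (e * e)) (≤-reflexive (eq₄ e))
  δ²+3δ≤m : δ * δ + 3 * δ ≤ m
  δ²+3δ≤m = +-cancelʳ-≤ m _ _ (begin
    δ * δ + 3 * δ + m                          ≡⟨ eq₃ δ m ⟩
    δ * δ + δ + (2 * δ + m)                    ≡⟨ cong (λ k → δ * δ + δ + (k ∸ 2)) (sym (eq₂ δ m)) ⟩
    δ * δ + δ + (2 * δ + 2 + m ∸ 2)            ≤⟨ Ln4TimesGE⇒≤ (2 * δ + 2 + m ∸ (2 * δ + 2)) _ h ⟩
    2 * (2 * δ + 2 + m ∸ (2 * δ + 2))          ≡⟨ cong (2 *_) (m+n∸m≡n (2 * δ + 2) m) ⟩
    2 * m                                      ≡⟨ cong (m +_) (+-identityʳ m) ⟩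
    m + m                                      ∎)

-- The enumeration of all subsets, and tallies over lists.

addVertex : ∀ {n} → ℕ → (Fin n → Bool) → Fin n → Bool
addVertex k = λ S v → if toℕ v ≡ᵇ k then true else S v

-- Given as a function of `k` alone, so that it unfolds to the very abstraction mapped inside
-- `allSubsets`.
withAndWithout : ∀ {n} → ℕ → (Fin n → Bool) → List (Fin n → Bool)
withAndWithout k = λ S → S ∷ addVertex k S ∷ []

subsetsBelow : ∀ n → ℕ → List (Fin n → Bool)
subsetsBelow n zero    = (λ _ → false) ∷ []
subsetsBelow n (suc k) = concatMap (withAndWithout k) (subsetsBelow n k)

subsetsBelow-unique : (f : ∀ n → ℕ → List (Fin n → Bool)) → (∀ n → f n zero ≡ (λ _ → false) ∷ []) →
  (∀ n k → f n (suc k) ≡ concatMap (withAndWithout k) (f n k)) → ∀ n k → f n k ≡ subsetsBelow n k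
subsetsBelow-unique f z s n zero    = z n
subsetsBelow-unique f z s n (suc k) = ≡-trans (s n k) (cong (concatMap _) (subsetsBelow-unique f z s n k))

-- The recursion inside allSubsets is local to Defs and cannot be named. Generalising suc k to w
-- turns the two occurrences of it in the goal into an instance at two distinct variables, from
-- which the function left open in go≡subsetsBelow is inferred.
mutual
  go≡subsetsBelow : ∀ n k → _ ≡ subsetsBelow n k
  go≡subsetsBelow = subsetsBelow-unique _ (λ _ → refl) (λ _ _ → refl)

  allSubsets≡ : ∀ n → allSubsets n ≡ subsetsBelow n n
  allSubsets≡ zero = refl
  allSubsets≡ (suc k) with suc k | map (withAndWithout {suc k} k)
  ... | w | h = cong (λ Ss → foldr _++_ [] (h Ss)) (go≡subsetsBelow w k)

module _ {A : Set} where

  tally : (A → Bool) → List A → ℕ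
  tally p xs = sum (map (λ x → if p x then 1 else 0) xs)

  tally≡length-filterᵇ : ∀ p xs → tally p xs ≡ length (filterᵇ p xs)
  tally≡length-filterᵇ p [] = refl
  tally≡length-filterᵇ p (x ∷ xs) with p x
  ... | true  = cong suc (tally≡length-filterᵇ p xs)
  ... | false = tally≡length-filterᵇ p xs

  tally-cong : ∀ {p q : A → Bool} → (∀ x → p x ≡ q x) → ∀ xs → tally p xs ≡ tally q xs
  tally-cong p≗q xs = cong sum (map-cong (λ x → cong (if_then 1 else 0) (p≗q x)) xs)

  tally-false : ∀ (xs : List A) → tally (const false) xs ≡ 0
  tally-false [] = refl
  tally-false (x ∷ xs) = tally-false xs

  tally-pairs : ∀ (p : A → Bool) f xs →
    tally p (concatMap (λ x → x ∷ f x ∷ []) xs) ≡ tally p xs + tally (p ∘ f) xs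
  tally-pairs p f [] = refl
  tally-pairs p f (x ∷ xs) = ≡-trans (cong (λ k → a + (b + k)) (tally-pairs p f xs)) (eq a b _ _)
    where
    a = if p x then 1 else 0
    b = if p (f x) then 1 else 0
    eq : ∀ a b c d → a + (b + (c + d)) ≡ a + c + (b + d)
    eq = solve-∀

and-true⇔ : ∀ bs → and bs ≡ true ⇔ All (_≡ true) bs
and-true⇔ bs = mk⇔ (to bs) from
  where
  to : ∀ bs → and bs ≡ true → All (_≡ true) bs
  to [] _ = []
  to (true ∷ bs) h = refl ∷ to bs h
  from : ∀ {bs} → All (_≡ true) bs → and bs ≡ true
  from [] = refl
  from (refl ∷ h) = from h

all⁺ : ∀ {n} {P : Fin n → Set} → (∀ v → P v) → All P (allFin n)
all⁺ h = All.tabulate (λ {v} _ → h v)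

all⁻ : ∀ {n} {P : Fin n → Set} → All P (allFin n) → ∀ v → P v
all⁻ h v = All.lookup h (∈-allFin v)

-- The number `i G` as a count over the list of all vertices.

module _ {n} (G : Graph n) where
  open IndependentSets (adj G) (adj-sym G) (adj-irrefl G)

  IsIndependent : (Fin n → Bool) → Set
  IsIndependent S = ∀ u v → S u ≡ true → S v ≡ true → adj G u v ≡ false

  isIndependent⇔ : ∀ S → isIndependent G S ≡ true ⇔ IsIndependent S
  isIndependent⇔ S = mk⇔
    (λ h u v → nand⁻ (all⁻ (All.map⁻ (all⁻ (All.map⁻ (All.concat⁻ (Equivalence.to (and-true⇔ _) h))) u)) v))
    (λ h → Equivalence.from (and-true⇔ _)
      (All.concat⁺ (All.map⁺ (all⁺ λ u → All.map⁺ (all⁺ λ v → nand⁺ (h u v))))))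
    where
    nand⁻ : ∀ {a b c} → not (a ∧ b ∧ c) ≡ true → a ≡ true → b ≡ true → c ≡ false
    nand⁻ {c = false} _ refl refl = refl
    nand⁺ : ∀ {a b c} → (a ≡ true → b ≡ true → c ≡ false) → not (a ∧ b ∧ c) ≡ true
    nand⁺ {false} _ = refl
    nand⁺ {true} {false} _ = refl
    nand⁺ {true} {true} h rewrite h refl refl = refl

  within : (Fin n → Bool) → (Fin n → Bool) → Bool
  within p S = and (map (λ v → not (S v) ∨ p v) (allFin n))

  within⇔ : ∀ p S → within p S ≡ true ⇔ (∀ v → S v ≡ true → p v ≡ true)
  within⇔ p S = mk⇔
    (λ h v → imp⁻ (all⁻ (All.map⁻ (Equivalence.to (and-true⇔ _) h)) v))
    (λ h → Equivalence.from (and-true⇔ _) (All.map⁺ (all⁺ λ v → imp⁺ (h v))))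
    where
    imp⁻ : ∀ {a b} → not a ∨ b ≡ true → a ≡ true → b ≡ true
    imp⁻ h refl = h
    imp⁺ : ∀ {a b} → (a ≡ true → b ≡ true) → not a ∨ b ≡ true
    imp⁺ {false} _ = refl
    imp⁺ {true} h = h refl

  -- Tests for the sets that `cnt p` counts: independent, with all members satisfying `p`.
  good : (Fin n → Bool) → (Fin n → Bool) → Bool
  good p S = isIndependent G S ∧ within p S

  Good : (Fin n → Bool) → (Fin n → Bool) → Set
  Good p S = IsIndependent S × (∀ v → S v ≡ true → p v ≡ true)

  good⇔ : ∀ p S → good p S ≡ true ⇔ Good p S
  good⇔ p S = mk⇔ (λ h → Equivalence.to (isIndependent⇔ S) (∧-conicalˡ _ _ h) ,
         Equivalence.to (within⇔ p S) (∧-conicalʳ (isIndependent G S) _ h))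
    (λ (ind , w) → cong₂ _∧_ (Equivalence.from (isIndependent⇔ S) ind) (Equivalence.from (within⇔ p S) w))

  good-empty : ∀ p → good p (const false) ≡ true
  good-empty p = Equivalence.from (good⇔ p _) ((λ _ _ ()) , (λ _ ()))

  -- This mirrors the second summum of `cnt`: choosing `w` needs `p w` and confines the other
  -- members to non-neighbours of `w`.
  good-add : ∀ p w S → good p (addVertex (toℕ w) S) ≡ p w ∧ good (λ u → p u ∧ not (adj G w u)) S
  good-add p w S = ⇔→≡ (mk⇔ to from)
    where
    S⁺ = addVertex (toℕ w) S
    p′ = λ u → p u ∧ not (adj G w u)
    w∈ : S⁺ w ≡ true
    w∈ rewrite Equivalence.to T-≡ (≡⇒≡ᵇ (toℕ w) _ refl) = refl
    old : ∀ u → S u ≡ true → S⁺ u ≡ true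
    old u Su with toℕ u ≡ᵇ toℕ w
    ... | true = refl
    ... | false = Su
    new : ∀ u → S⁺ u ≡ true → u ≡ w ⊎ S u ≡ true
    new u S⁺u with toℕ u ≡ᵇ toℕ w in eq
    ... | true = inj₁ (toℕ-injective (≡ᵇ⇒≡ _ _ (subst T (sym eq) _)))
    ... | false = inj₂ S⁺u
    and-not : ∀ {a b} → a ≡ true → b ≡ false → a ∧ not b ≡ true
    and-not refl refl = refl
    to : good p S⁺ ≡ true → p w ∧ good p′ S ≡ true
    to h with Equivalence.to (good⇔ p S⁺) h
    ... | ind , ⊆p = cong₂ _∧_ (⊆p w w∈) (Equivalence.from (good⇔ p′ S)
      ((λ u v Su Sv → ind u v (old u Su) (old v Sv)) ,
       (λ u Su → and-not (⊆p u (old u Su)) (ind w u w∈ (old u Su)))))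
    from : p w ∧ good p′ S ≡ true → good p S⁺ ≡ true
    from h with ∧-conicalˡ (p w) _ h | Equivalence.to (good⇔ p′ S) (∧-conicalʳ (p w) _ h)
    ... | pw | ind , ⊆p′ = Equivalence.from (good⇔ p S⁺) (ind′ , ⊆p)
      where
      nonadj : ∀ u → S u ≡ true → adj G w u ≡ false
      nonadj u Su = not-injective (∧-conicalʳ (p u) _ (⊆p′ u Su))
      ind′ : IsIndependent S⁺
      ind′ u v hu hv with new u hu | new v hv
      ... | inj₁ refl | inj₁ refl = adj-irrefl G w
      ... | inj₁ refl | inj₂ Sv = nonadj v Sv
      ... | inj₂ Su | inj₁ refl = ≡-trans (adj-sym G u w) (nonadj u Su)
      ... | inj₂ Su | inj₂ Sv = ind u v Su Sv
      ⊆p : ∀ u → S⁺ u ≡ true → p u ≡ true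
      ⊆p u hu with new u hu
      ... | inj₁ refl = pw
      ... | inj₂ Su = ∧-conicalˡ (p u) _ (⊆p′ u Su)

  -- Decreasing order, because the last step of `subsetsBelow` adds the largest vertex while `cnt`
  -- expands at the head.
  downFin : ∀ k → k ≤ n → List (Fin n)
  downFin zero _ = []
  downFin (suc k) k<n = fromℕ< k<n ∷ downFin k (<⇒≤ k<n)

  tally-good : ∀ k (k≤n : k ≤ n) p → tally (good p) (subsetsBelow n k) ≡ cnt p (downFin k k≤n)
  tally-good zero _ p rewrite good-empty p = refl
  tally-good (suc k) k<n p = begin
    tally (good p) (subsetsBelow n (suc k))
      ≡⟨ tally-pairs (good p) (addVertex k) (subsetsBelow n k) ⟩
    tally (good p) (subsetsBelow n k) + tally (good p ∘ addVertex k) (subsetsBelow n k)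
      ≡⟨ cong₂ _+_ (tally-good k _ p) (≡-trans (tally-cong good-add′ (subsetsBelow n k)) (split (p w))) ⟩
    cnt p (downFin (suc k) k<n) ∎
    where
    open ≡-Reasoning
    w = fromℕ< k<n
    p′ = λ u → p u ∧ not (adj G w u)
    good-add′ : ∀ S → good p (addVertex k S) ≡ p w ∧ good p′ S
    good-add′ S = ≡-trans (cong (λ j → good p (addVertex j S)) (sym (toℕ-fromℕ< k<n))) (good-add p w S)
    split : ∀ b → tally (λ S → b ∧ good p′ S) (subsetsBelow n k) ≡ (if b then cnt p′ (downFin k (<⇒≤ k<n)) else 0)
    split true = tally-good k _ p′
    split false = tally-false (subsetsBelow n k)

  -- Both lists are free of repetitions and contain every vertex.
  downFin↭allFin : downFin n ≤-refl ↭ allFin n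
  downFin↭allFin = ∼bag⇒↭ (unique∧set⇒bag (unique n ≤-refl) (allFin⁺ n)
    (λ {v} → mk⇔ (λ _ → ∈-allFin v) (λ _ → ∈-down n ≤-refl v (toℕ<n v))))
    where
    all< : ∀ k k≤n → All (λ v → toℕ v < k) (downFin k k≤n)
    all< zero _ = []
    all< (suc k) k<n = ≤-reflexive (cong suc (toℕ-fromℕ< k<n)) ∷ All.map m≤n⇒m≤1+n (all< k _)
    unique : ∀ k k≤n → Unique (downFin k k≤n)
    unique zero _ = []
    unique (suc k) k<n =
      All.map (λ v<k w≡v → <-irrefl (≡-trans (cong toℕ (sym w≡v)) (toℕ-fromℕ< k<n)) v<k) (all< k _) ∷ unique k _
    ∈-down : ∀ k k≤n v → toℕ v < k → v ∈ downFin k k≤n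
    ∈-down (suc k) k<n v v<k with m≤n⇒m<n∨m≡n (s≤s⁻¹ v<k)
    ... | inj₁ v<k = there (∈-down k _ v v<k)
    ... | inj₂ v≡k = here (toℕ-injective (≡-trans v≡k (sym (toℕ-fromℕ< k<n))))

  i≡count : i G ≡ count (allFin n)
  i≡count = begin
    i G                                               ≡⟨ cong (tally (isIndependent G)) (allSubsets≡ n) ⟩
    tally (isIndependent G) (subsetsBelow n n)        ≡⟨ tally-cong all-within (subsetsBelow n n) ⟩
    tally (good (const true)) (subsetsBelow n n)      ≡⟨ tally-good n ≤-refl _ ⟩
    count (downFin n ≤-refl)                          ≡⟨ cnt-↭ downFin↭allFin _ ⟩
    count (allFin n)                                  ∎
    where
    open ≡-Reasoning
    all-within : ∀ S → isIndependent G S ≡ good (const true) S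
    all-within S = ⇔→≡ (mk⇔
      (λ h → cong₂ _∧_ h (Equivalence.from (within⇔ (const true) S) λ _ _ → refl))
      (λ h → ∧-conicalˡ _ _ h))

  degree≡deg : ∀ v → degree G v ≡ deg v (allFin n)
  degree≡deg v = tally≡length-filterᵇ (adj G v) (allFin n)

-- The independent sets of `Kbip`.

allPairs⁺ : ∀ {A : Set} {P : A → Set} {R : A → A → Set} → (∀ {x y} → P x → P y → R x y) →
  ∀ {xs} → All P xs → AllPairs R xs
allPairs⁺ h [] = []
allPairs⁺ h (px ∷ pxs) = All.map (h px) pxs ∷ allPairs⁺ h pxs

length-filterᵇ-map : ∀ {A B : Set} (p : B → Bool) (f : A → B) xs →
  length (filterᵇ p (map f xs)) ≡ length (filterᵇ (p ∘ f) xs)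
length-filterᵇ-map p f [] = refl
length-filterᵇ-map p f (x ∷ xs) with p (f x)
... | true  = cong suc (length-filterᵇ-map p f xs)
... | false = length-filterᵇ-map p f xs

length-filterᵇ-<ᵇ : ∀ n δ → δ ≤ n → length (filterᵇ (λ v → toℕ v <ᵇ δ) (allFin n)) ≡ δ
length-filterᵇ-<ᵇ n zero _ = cong length (filterᵇ-none _ (allFin n) (all⁺ λ _ → refl))
length-filterᵇ-<ᵇ (suc n) (suc δ) (s≤s δ≤n) = cong suc (begin
  length (filterᵇ below (tabulate fsuc))           ≡⟨ cong (length ∘ filterᵇ below) (sym (map-tabulate id fsuc)) ⟩
  length (filterᵇ below (map fsuc (allFin n)))     ≡⟨ length-filterᵇ-map below fsuc (allFin n) ⟩
  length (filterᵇ (λ v → toℕ v <ᵇ δ) (allFin n))   ≡⟨ length-filterᵇ-<ᵇ n δ δ≤n ⟩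
  δ                                                ∎)
  where
  open ≡-Reasoning
  below : Fin (suc n) → Bool
  below v = toℕ v <ᵇ suc δ

length-allFin : ∀ n → length (allFin n) ≡ n
length-allFin n = length-tabulate id

i-Kbip : ∀ δ q → i (Kbip (δ + q) δ) + 1 ≡ 2 ^ q + 2 ^ δ
i-Kbip δ q = begin
  i K + 1                       ≡⟨ cong (_+ 1) (≡-trans (i≡count K) (cnt-↭ W↭ _)) ⟩
  count (A ++ B) + 1            ≡⟨ count-completeBipartite A B (allPairs⁺ same A-low) (allPairs⁺ same B-high)
                                     (All.map (λ a → All.map (opposite a) B-high) A-low) ⟩
  2 ^ length B + 2 ^ length A   ≡⟨ cong₂ (λ k l → 2 ^ k + 2 ^ l) B≡ A≡ ⟩
  2 ^ q + 2 ^ δ                 ∎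
  where
  open ≡-Reasoning
  K = Kbip (δ + q) δ
  open IndependentSets (adj K) (adj-sym K) (adj-irrefl K)
  low : Fin (δ + q) → Bool
  low v = toℕ v <ᵇ δ
  A = filterᵇ low (allFin (δ + q))
  B = filterᵇ (not ∘ low) (allFin (δ + q))
  W↭ : allFin (δ + q) ↭ A ++ B
  W↭ = filterᵇ-partition low (allFin (δ + q))
  A-low : All (λ v → low v ≡ true) A
  A-low = filterᵇ-satisfies low (allFin (δ + q))
  B-high : All (λ v → low v ≡ false) B
  B-high = All.map not-injective (filterᵇ-satisfies (not ∘ low) (allFin (δ + q)))
  same : ∀ {b u v} → low u ≡ b → low v ≡ b → adj K u v ≡ false
  same {true} u v rewrite u | v = refl
  same {false} u v rewrite u | v = refl
  opposite : ∀ {u v} → low u ≡ true → low v ≡ false → adj K u v ≡ true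
  opposite u v rewrite u | v = refl
  A≡ : length A ≡ δ
  A≡ = length-filterᵇ-<ᵇ (δ + q) δ (m≤m+n δ q)
  B≡ : length B ≡ q
  B≡ = +-cancelˡ-≡ δ _ _ (begin
    δ + length B              ≡⟨ cong (_+ length B) (sym A≡) ⟩
    length A + length B       ≡⟨ sym (length-++ A) ⟩
    length (A ++ B)           ≡⟨ sym (↭-length W↭) ⟩
    length (allFin (δ + q))   ≡⟨ length-allFin (δ + q) ⟩
    δ + q                     ∎)

-- From a bipartition of the vertex list to an isomorphism with `Kbip`.

-- The Boolean test on the position is the one by which `Kbip` separates its two parts.
lookup-++-side : ∀ {X : Set} (A B : List X) j →
  ((toℕ j <ᵇ length A) ≡ true × lookup (A ++ B) j ∈ A) ⊎ ((toℕ j <ᵇ length A) ≡ false × lookup (A ++ B) j ∈ B)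
lookup-++-side [] B j = inj₂ (refl , ∈-lookup j)
lookup-++-side (a ∷ A) B fzero = inj₁ (refl , here refl)
lookup-++-side (a ∷ A) B (fsuc j) = Sum.map₁ (λ (j< , ∈A) → j< , there ∈A) (lookup-++-side A B j)

module _ {n} (G : Graph n) where
  open IndependentSets (adj G) (adj-sym G) (adj-irrefl G)

  independent-∈ : ∀ {W u v} → Independent W → u ∈ W → v ∈ W → adj G u v ≡ false
  independent-∈ {u = u} (_ ∷ _) (here refl) (here refl) = adj-irrefl G u
  independent-∈ (none ∷ _) (here refl) (there v∈) = All.lookup none v∈
  independent-∈ {u = u} (none ∷ _) (there u∈) (here refl) = ≡-trans (adj-sym G u _) (All.lookup none u∈)
  independent-∈ (_ ∷ ind) (there u∈) (there v∈) = independent-∈ ind u∈ v∈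

  -- Each vertex is sent to its position in `A ++ B`; the positions below `length A = δ` are those
  -- of `A`.
  completeBipartite⇒≅ : ∀ {δ} → CompleteBipartite δ (allFin n) → G ≅ Kbip n δ
  completeBipartite⇒≅ (A , B , W↭ , refl , indA , indB , AB) = π , λ u v → begin
    adj G u v                                    ≡⟨ cong₂ (adj G) (lookup-position u) (lookup-position v) ⟩
    adj G (lookup (A ++ B) (position u)) (lookup (A ++ B) (position v))
      ≡⟨ by-side (lookup-++-side A B (position u)) (lookup-++-side A B (position v)) ⟩
    (toℕ (position u) <ᵇ length A) xor (toℕ (position v) <ᵇ length A)
      ≡⟨ cong₂ (λ j k → (j <ᵇ length A) xor (k <ᵇ length A))
           (sym (toℕ-cast AB≡ (position u))) (sym (toℕ-cast AB≡ (position v))) ⟩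
    adj (Kbip n (length A)) (π ⟨$⟩ʳ u) (π ⟨$⟩ʳ v) ∎
    where
    open ≡-Reasoning
    W↭ₛ = ↭⇒↭ₛ W↭
    AB≡ : length (A ++ B) ≡ n
    AB≡ = ≡-trans (sym (↭-length W↭)) (length-allFin n)
    -- The list permutation acts on positions; the casts identify the list lengths with `n`.
    σ = cast-id (sym (length-allFin n)) ∘ₚ onIndices W↭ₛ
    π : Permutation′ n
    π = σ ∘ₚ cast-id AB≡
    position : Fin n → Fin (length (A ++ B))
    position u = σ ⟨$⟩ʳ u
    lookup-position : ∀ u → u ≡ lookup (A ++ B) (position u)
    lookup-position u = ≡-trans (sym (lookup-tabulate id u)) (onIndices-lookup (setoid (Fin n)) W↭ₛ _)
    by-side : ∀ {u v} {a b : Bool} →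
      (a ≡ true × u ∈ A) ⊎ (a ≡ false × u ∈ B) → (b ≡ true × v ∈ A) ⊎ (b ≡ false × v ∈ B) →
      adj G u v ≡ a xor b
    by-side (inj₁ (refl , u∈A)) (inj₁ (refl , v∈A)) = independent-∈ indA u∈A v∈A
    by-side (inj₁ (refl , u∈A)) (inj₂ (refl , v∈B)) = All.lookup (All.lookup AB u∈A) v∈B
    by-side (inj₂ (refl , u∈B)) (inj₁ (refl , v∈A)) = ≡-trans (adj-sym G _ _) (All.lookup (All.lookup AB v∈A) u∈B)
    by-side (inj₂ (refl , u∈B)) (inj₂ (refl , v∈B)) = independent-∈ indB u∈B v∈B

theorem1p5 : (n δ : ℕ) (G : Graph n) → MinDegreeAtLeast G δ → SizeCondition n δ →
    (G ≅ Kbip n δ) ⊎ (i G < i (Kbip n δ))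
theorem1p5 n δ G δ≤ size with sizeCondition⇒ n δ size
... | q , refl , 6δ<q = Sum.map (completeBipartite⇒≅ G)
  (λ few → +-cancelʳ-< 1 _ _ (subst₂ _<_ (cong (_+ 1) (sym (i≡count G))) (sym (i-Kbip δ q)) few))
  (IndependentSets.bipartite-or-few (adj G) (adj-sym G) (adj-irrefl G) δ q
    (allFin (δ + q)) (length-allFin (δ + q)) 6δ<q (all⁺ λ v → ≤-trans (δ≤ v) (≤-reflexive (degree≡deg G v))))
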